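{- Let $U$ be a nonempty set. For every MSO formula $\varphi$, range-relative validity over $U$ coincides with general (Henkin-style) validity over $U$: $$\bigl(\forall I\ \forall g\ \forall G.\ \langle I,\mathrm{Range}(g),\mathrm{Range}(G)\rangle,g,G\models^d\varphi\bigr)\iff\ \models^d\varphi ,$$ where $I$ ranges over all interpretations over $U$, $g$ over all maps $V\to U$ and $G$ over all maps $V_2\to\mathcal P(U)$. Equivalently, the minimal-shallow embedding is faithful exactly to general validity: $\models^d\varphi$ holds if and only if the proposition $(\!|\varphi|\!)_{II,gg,GG}$ is true for every interpretation $II$ over $U$, every $gg:V\to U$ and every $GG:V_2\to\mathcal P(U)$.
   Context: **Syntax.** Relation symbols $R=\mathbb N$, first-order variables $V=\mathbb N$ and second-order (monadic) variables $V_2=\mathbb N$ (the two kinds of variables form separate namespaces). MSO formulas: $\varphi,\psi ::= r(x,y)\mid X(x)\mid\neg\varphi\mid\varphi\wedge\psi\mid\exists x.\varphi\mid\exists X.\varphi$ with $r\in R$, $x,y\in V$, $X\in V_2$ (no equality). **Semantics.** $U$ is a fixed nonempty set (the type of individuals). An interpretation $I$ over $U$ assigns to each $r\in R$ a binary relation $I(r)\subseteq U\times U$. Given $I$, a set $D\subseteq U$, a family $E\subseteq\mathcal P(U)$ (no closure condition on $E$), and assignments $g:V\to U$, $G:V_2\to\mathcal P(U)$, truth $\langle I,D,E\rangle,g,G\models^d\varphi$ is defined recursively: $r(x,y)$ holds iff $(g(x),g(y))\in I(r)$; $X(x)$ holds iff $g(x)\in G(X)$; $\neg,\wedge$ are classical;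 $\exists x.\varphi$ holds iff $\langle I,D,E\rangle,g[x\leftarrow d],G\models^d\varphi$ for some $d\in D$; $\exists X.\varphi$ holds iff $\langle I,D,E\rangle,g,G\langle X\leftarrow S\rangle\models^d\varphi$ for some $S\in E$. Here $g[x\leftarrow d]$ and $G\langle X\leftarrow S\rangle$ are the usual updates. **General validity.** $\models^d\varphi$ means: for all $I$, $D\subseteq U$, $E\subseteq\mathcal P(U)$, all $g$ with $\mathrm{Range}(g)\subseteq D$ and all $G$ with $\mathrm{Range}(G)\subseteq E$, $\langle I,D,E\rangle,g,G\models^d\varphi$. **Safe substitution.** $[x\leftarrow_r z](\varphi)$ (for $x,z\in V$) is capture-avoiding substitution: first rename every binder $\exists z$ in $\varphi$, together with the occurrences it binds, to $\exists w$ for a fresh variable $w$ (say the least one not occurring in $\varphi$ and different from $x,z$), then replace all free occurrences of $x$ by $z$. $[X\leftarrow_{r2}Z](\varphi)$ for $X,Z\in V_2$ is the analogous operation for second-order variables. Binders of one namespace do not interact with substitution in the other. Both operations preserve formula size. **Minimal-shallow translation.** For parameters $II$ (an interpretation over $U$), $gg:V\to U$, $GG:V_2\to\mathcal P(U)$, the truth value $(\!|\varphi|\!)=(\!|\varphi|\!)_{II,gg,GG}$ is defined by recursion on formula size: $(\!|r(x,y)|\!)$ is $(gg(x),gg(y))\in II(r)$; $(\!|X(x)|\!)$ is $gg(x)\in GG(X)$; $(\!|\neg\varphi|\!)$ is $\neg(\!|\varphi|\!)$; $(\!|\varphi\wedge\psi|\!)$ is $(\!|\varphi|\!)\wedge(\!|\psi|\!)$;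 $(\!|\exists x.\varphi|\!)$ is "there is a variable $z\in V$ with $(\!|[x\leftarrow_r z](\varphi)|\!)$"; $(\!|\exists X.\varphi|\!)$ is "there is a variable $Z\in V_2$ with $(\!|[X\leftarrow_{r2}Z](\varphi)|\!)$". -}

module Defs where

open import Level using (Level; Lift) renaming (suc to lsuc)
open import Data.Bool.Base using (true; false; if_then_else_)
open import Data.Nat using (ℕ; suc; _+_; _<_; s≤s; _≟_)
open import Data.Nat.Properties
  using (n<1+n; m≤m+n; m≤n+m; ≤-reflexive)
open import Data.Nat.Induction using (Acc; acc; <-wellFounded)
open import Data.Fin.Base using (Fin; toℕ; fromℕ<)
open import Data.Fin.Properties
  using (¬∀⟶∃¬-smallest; pigeonhole; toℕ-injective; toℕ-inject; toℕ-fromℕ<; <⇒≢)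
open import Data.List.Base using (List; []; _∷_; _++_; length)
open import Data.List.Membership.Propositional using (_∈_; _∉_)
open import Data.List.Membership.DecPropositional _≟_ using (_∈?_)
open import Data.List.Membership.Setoid.Properties using (index-injective)
open import Data.List.Relation.Unary.Any using (index)
open import Data.Product.Base using (∃-syntax; _×_; _,_; proj₁)
open import Relation.Binary.Core using (Rel)
open import Relation.Binary.Definitions using (_Respects_)
open import Relation.Binary.PropositionalEquality
  using (_≡_; refl; sym; trans; cong; cong₂; subst; setoid)
open import Relation.Nullary using (¬_)
open import Relation.Nullary.Decidable using (does)
open import Relation.Unary as Unary using (Pred; _≐_; _⊆_)

private
  variable
    a b : Level

------------------------------------------------------------------------
-- Syntax

RelSym Var Var₂ : Set
RelSym = ℕ
Var    = ℕ
Var₂   = ℕ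

infixr 6 _∧′_

data Formula : Set where
  rel  : RelSym → Var → Var → Formula
  mem  : Var₂ → Var → Formula
  ¬′_  : Formula → Formula
  _∧′_ : Formula → Formula → Formula
  ∃¹   : Var → Formula → Formula
  ∃²   : Var₂ → Formula → Formula

size : Formula → ℕ
size (rel r x y) = 1
size (mem X x)   = 1
size (¬′ φ)      = suc (size φ)
size (φ ∧′ ψ)    = suc (size φ + size ψ)
size (∃¹ x φ)    = suc (size φ)
size (∃² X φ)    = suc (size φ)

-- All occurrences are collected: free, bound, and in binders.

vars₁ : Formula → List Var
vars₁ (rel r x y) = x ∷ y ∷ []
vars₁ (mem X x)   = x ∷ []
vars₁ (¬′ φ)      = vars₁ φ
vars₁ (φ ∧′ ψ)    = vars₁ φ ++ vars₁ ψ
vars₁ (∃¹ x φ)    = x ∷ vars₁ φ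
vars₁ (∃² X φ)    = vars₁ φ

vars₂ : Formula → List Var₂
vars₂ (rel r x y) = []
vars₂ (mem X x)   = X ∷ []
vars₂ (¬′ φ)      = vars₂ φ
vars₂ (φ ∧′ ψ)    = vars₂ φ ++ vars₂ ψ
vars₂ (∃¹ x φ)    = vars₂ φ
vars₂ (∃² X φ)    = X ∷ vars₂ φ

------------------------------------------------------------------------
-- Safe substitution

not-all-∈ : (xs : List ℕ) → ¬ (∀ (i : Fin (suc (length xs))) → toℕ i ∈ xs)
not-all-∈ xs all
  with i , j , i<j , eq ← pigeonhole (n<1+n (length xs)) (λ i → index (all i))
  = <⇒≢ i<j (toℕ-injective (index-injective (setoid ℕ) (all i) (all j) eq))

leastFresh : (xs : List ℕ) →
             ∃[ w ] (w ∉ xs × (∀ {v} → v < w → v ∈ xs))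
leastFresh xs
  with i , i∉xs , below ← ¬∀⟶∃¬-smallest (suc (length xs))
         (λ i → toℕ i ∈ xs) (λ i → toℕ i ∈? xs) (not-all-∈ xs)
  = toℕ i , i∉xs , λ v<w →
      subst (_∈ xs) (trans (toℕ-inject (fromℕ< v<w)) (toℕ-fromℕ< v<w))
            (below (fromℕ< v<w))

fresh : List ℕ → ℕ
fresh xs = proj₁ (leastFresh xs)

_[_/_] : ℕ → ℕ → ℕ → ℕ
y [ z / x ] = if does (y ≟ x) then z else y

-- Replacement of the free occurrences of x by z, with no regard to capture.

replace₁ : Var → Var → Formula → Formula
replace₁ x z (rel r y y′) = rel r (y [ z / x ]) (y′ [ z / x ])
replace₁ x z (mem Y y)    = mem Y (y [ z / x ])
replace₁ x z (¬′ φ)       = ¬′ replace₁ x z φ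
replace₁ x z (φ ∧′ ψ)     = replace₁ x z φ ∧′ replace₁ x z ψ
replace₁ x z (∃¹ y φ)     = ∃¹ y (if does (y ≟ x) then φ else replace₁ x z φ)
replace₁ x z (∃² Y φ)     = ∃² Y (replace₁ x z φ)

replace₂ : Var₂ → Var₂ → Formula → Formula
replace₂ X Z (rel r y y′) = rel r y y′
replace₂ X Z (mem Y y)    = mem (Y [ Z / X ]) y
replace₂ X Z (¬′ φ)       = ¬′ replace₂ X Z φ
replace₂ X Z (φ ∧′ ψ)     = replace₂ X Z φ ∧′ replace₂ X Z ψ
replace₂ X Z (∃¹ y φ)     = ∃¹ y (replace₂ X Z φ)
replace₂ X Z (∃² Y φ)     = ∃² Y (if does (Y ≟ X) then φ else replace₂ X Z φ)

-- Renaming of every binder of z, with the occurrences it binds, to w.  Inner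
-- binders are renamed first, so the occurrences of z bound by an outer binder
-- are exactly those still free in its renamed body.

renameBound₁ : Var → Var → Formula → Formula
renameBound₁ z w (rel r y y′) = rel r y y′
renameBound₁ z w (mem Y y)    = mem Y y
renameBound₁ z w (¬′ φ)       = ¬′ renameBound₁ z w φ
renameBound₁ z w (φ ∧′ ψ)     = renameBound₁ z w φ ∧′ renameBound₁ z w ψ
renameBound₁ z w (∃¹ y φ)     =
  if does (y ≟ z) then ∃¹ w (replace₁ z w (renameBound₁ z w φ))
                  else ∃¹ y (renameBound₁ z w φ)
renameBound₁ z w (∃² Y φ)     = ∃² Y (renameBound₁ z w φ)

renameBound₂ : Var₂ → Var₂ → Formula → Formula
renameBound₂ Z W (rel r y y′) = rel r y y′
renameBound₂ Z W (mem Y y)    = mem Y y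
renameBound₂ Z W (¬′ φ)       = ¬′ renameBound₂ Z W φ
renameBound₂ Z W (φ ∧′ ψ)     = renameBound₂ Z W φ ∧′ renameBound₂ Z W ψ
renameBound₂ Z W (∃¹ y φ)     = ∃¹ y (renameBound₂ Z W φ)
renameBound₂ Z W (∃² Y φ)     =
  if does (Y ≟ Z) then ∃² W (replace₂ Z W (renameBound₂ Z W φ))
                  else ∃² Y (renameBound₂ Z W φ)

[_←ᵣ_] : Var → Var → Formula → Formula
[ x ←ᵣ z ] φ = replace₁ x z (renameBound₁ z (fresh (x ∷ z ∷ vars₁ φ)) φ)

[_←ᵣ₂_] : Var₂ → Var₂ → Formula → Formula
[ X ←ᵣ₂ Z ] φ = replace₂ X Z (renameBound₂ Z (fresh (X ∷ Z ∷ vars₂ φ)) φ)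

size-replace₁ : ∀ x z φ → size (replace₁ x z φ) ≡ size φ
size-replace₁ x z (rel r y y′) = refl
size-replace₁ x z (mem Y y)    = refl
size-replace₁ x z (¬′ φ)       = cong suc (size-replace₁ x z φ)
size-replace₁ x z (φ ∧′ ψ)     =
  cong suc (cong₂ _+_ (size-replace₁ x z φ) (size-replace₁ x z ψ))
size-replace₁ x z (∃¹ y φ) with does (y ≟ x)
... | true  = refl
... | false = cong suc (size-replace₁ x z φ)
size-replace₁ x z (∃² Y φ)     = cong suc (size-replace₁ x z φ)

size-replace₂ : ∀ X Z φ → size (replace₂ X Z φ) ≡ size φ
size-replace₂ X Z (rel r y y′) = refl
size-replace₂ X Z (mem Y y)    = refl
size-replace₂ X Z (¬′ φ)       = cong suc (size-replace₂ X Z φ)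
size-replace₂ X Z (φ ∧′ ψ)     =
  cong suc (cong₂ _+_ (size-replace₂ X Z φ) (size-replace₂ X Z ψ))
size-replace₂ X Z (∃¹ y φ)     = cong suc (size-replace₂ X Z φ)
size-replace₂ X Z (∃² Y φ) with does (Y ≟ X)
... | true  = refl
... | false = cong suc (size-replace₂ X Z φ)

size-renameBound₁ : ∀ z w φ → size (renameBound₁ z w φ) ≡ size φ
size-renameBound₁ z w (rel r y y′) = refl
size-renameBound₁ z w (mem Y y)    = refl
size-renameBound₁ z w (¬′ φ)       = cong suc (size-renameBound₁ z w φ)
size-renameBound₁ z w (φ ∧′ ψ)     =
  cong suc (cong₂ _+_ (size-renameBound₁ z w φ) (size-renameBound₁ z w ψ))
size-renameBound₁ z w (∃¹ y φ) with does (y ≟ z)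
... | true  = cong suc (trans (size-replace₁ z w (renameBound₁ z w φ))
                              (size-renameBound₁ z w φ))
... | false = cong suc (size-renameBound₁ z w φ)
size-renameBound₁ z w (∃² Y φ)     = cong suc (size-renameBound₁ z w φ)

size-renameBound₂ : ∀ Z W φ → size (renameBound₂ Z W φ) ≡ size φ
size-renameBound₂ Z W (rel r y y′) = refl
size-renameBound₂ Z W (mem Y y)    = refl
size-renameBound₂ Z W (¬′ φ)       = cong suc (size-renameBound₂ Z W φ)
size-renameBound₂ Z W (φ ∧′ ψ)     =
  cong suc (cong₂ _+_ (size-renameBound₂ Z W φ) (size-renameBound₂ Z W ψ))
size-renameBound₂ Z W (∃¹ y φ)     = cong suc (size-renameBound₂ Z W φ)
size-renameBound₂ Z W (∃² Y φ) with does (Y ≟ Z)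
... | true  = cong suc (trans (size-replace₂ Z W (renameBound₂ Z W φ))
                              (size-renameBound₂ Z W φ))
... | false = cong suc (size-renameBound₂ Z W φ)

size-subst₁ : ∀ x z φ → size ([ x ←ᵣ z ] φ) ≡ size φ
size-subst₁ x z φ =
  trans (size-replace₁ x z (renameBound₁ z w φ)) (size-renameBound₁ z w φ)
  where w = fresh (x ∷ z ∷ vars₁ φ)

size-subst₂ : ∀ X Z φ → size ([ X ←ᵣ₂ Z ] φ) ≡ size φ
size-subst₂ X Z φ =
  trans (size-replace₂ X Z (renameBound₂ Z w φ)) (size-renameBound₂ Z w φ)
  where w = fresh (X ∷ Z ∷ vars₂ φ)

------------------------------------------------------------------------
-- Henkin-style semantics

Interpretation : Set a → Set (lsuc a)
Interpretation {a} U = RelSym → Rel U a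

Assignment : Set a → Set a
Assignment U = Var → U

Assignment₂ : Set a → Set (lsuc a)
Assignment₂ {a} U = Var₂ → Pred U a

-- Sets are predicates up to _≐_, so a family of sets is a predicate on
-- predicates that respects _≐_.  This is extensionality only; the family is
-- not required to be closed under any operation on sets.

record SetFamily (U : Set a) : Set (lsuc a) where
  field
    member : Pred (Pred U a) a
    resp-≐ : member Respects _≐_

open SetFamily public

Range : {U : Set a} → Assignment U → Pred U a
Range g d = ∃[ x ] g x ≡ d

Range₂ : {U : Set a} → Assignment₂ U → SetFamily U
Range₂ G .member S = ∃[ X ] G X ≐ S
Range₂ G .resp-≐ (S⊆T , T⊆S) (X , GX⊆S , S⊆GX) =
  X , (λ p → S⊆T (GX⊆S p)) , (λ p → S⊆GX (T⊆S p))

_[_←_] : {A : Set b} → (ℕ → A) → ℕ → A → (ℕ → A)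
(g [ x ← d ]) y = if does (y ≟ x) then d else g y

infix 4 ⟨_,_,_⟩,_,_⊨_

⟨_,_,_⟩,_,_⊨_ : {U : Set a} → Interpretation U → Pred U a → SetFamily U →
                Assignment U → Assignment₂ U → Formula → Set (lsuc a)
⟨_,_,_⟩,_,_⊨_ {a} I D E g G (rel r x y) = Lift (lsuc a) (I r (g x) (g y))
⟨_,_,_⟩,_,_⊨_ {a} I D E g G (mem X x)   = Lift (lsuc a) (g x Unary.∈ G X)
⟨ I , D , E ⟩, g , G ⊨ (¬′ φ)   = ¬ (⟨ I , D , E ⟩, g , G ⊨ φ)
⟨ I , D , E ⟩, g , G ⊨ (φ ∧′ ψ) =
  (⟨ I , D , E ⟩, g , G ⊨ φ) × (⟨ I , D , E ⟩, g , G ⊨ ψ)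
⟨ I , D , E ⟩, g , G ⊨ ∃¹ x φ   =
  ∃[ d ] (d Unary.∈ D × (⟨ I , D , E ⟩, g [ x ← d ] , G ⊨ φ))
⟨ I , D , E ⟩, g , G ⊨ ∃² X φ   =
  ∃[ S ] (S Unary.∈ member E × (⟨ I , D , E ⟩, g , G [ X ← S ] ⊨ φ))

GenerallyValid : Set a → Formula → Set (lsuc a)
GenerallyValid {a} U φ =
  (I : Interpretation U) (D : Pred U a) (E : SetFamily U)
  (g : Assignment U) (G : Assignment₂ U) →
  Range g ⊆ D → member (Range₂ G) ⊆ member E →
  ⟨ I , D , E ⟩, g , G ⊨ φ

------------------------------------------------------------------------
-- Minimal-shallow translation

module _ {U : Set a}
         (II : Interpretation U) (gg : Assignment U) (GG : Assignment₂ U)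
  where

  shallowAcc : (φ : Formula) → Acc _<_ (size φ) → Set a
  shallowAcc (rel r x y) _        = II r (gg x) (gg y)
  shallowAcc (mem X x)   _        = gg x Unary.∈ GG X
  shallowAcc (¬′ φ)      (acc rs) = ¬ shallowAcc φ (rs (n<1+n _))
  shallowAcc (φ ∧′ ψ)    (acc rs) =
    shallowAcc φ (rs (s≤s (m≤m+n (size φ) (size ψ)))) ×
    shallowAcc ψ (rs (s≤s (m≤n+m (size ψ) (size φ))))
  shallowAcc (∃¹ x φ)    (acc rs) =
    ∃[ z ] shallowAcc ([ x ←ᵣ z ] φ) (rs (s≤s (≤-reflexive (size-subst₁ x z φ))))
  shallowAcc (∃² X φ)    (acc rs) =
    ∃[ Z ] shallowAcc ([ X ←ᵣ₂ Z ] φ) (rs (s≤s (≤-reflexive (size-subst₂ X Z φ))))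

  shallow : Formula → Set a
  shallow φ = shallowAcc φ (<-wellFounded (size φ))

{-# OPTIONS --safe #-}
module Submission where

-- The translation is pointwise range-relative truth: by the substitution lemma,
-- trying every variable z in [ x ←ᵣ z ] φ is the same as letting x range over
-- the values of gg.  Range-relative validity implies general validity by a
-- downward Löwenheim–Skolem argument: closing the values of g and G under
-- Skolem functions for all formulas gives countable subdomains with the same
-- truths.  They are enumerated by assignments g′ and G′ that keep the values of
-- g and G on the finitely many variables of φ, so that truth of φ is unaffected.

open import Defs
open import Level using (Level; lift; lower) renaming (suc to lsuc)
open import Axiom.ExcludedMiddle using (ExcludedMiddle)
open import Data.Bool.Base using (true; false)
open import Data.List.Base using (List; _∷_; _++_)
open import Data.List.Membership.Propositional using (_∈_; _∉_)
open import Data.List.Membership.Propositional.Properties using (∈-++⁺ˡ; ∈-++⁺ʳ; ∈-++⁻)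
import Data.List.Relation.Unary.All as All
open import Data.List.Relation.Unary.Any using (here; there)
open import Data.Nat.Base using (ℕ; zero; suc; _+_; _<_; s≤s)
open import Data.Nat.Induction using (Acc; acc)
open import Data.Nat.Properties
  using (_≟_; +-suc; +-assoc; +-comm; +-identityʳ; suc-injective; ≤-totalOrder)
open import Data.List.Extrema ≤-totalOrder using (max; xs≤max)
open import Data.Product.Base using (∃; ∃-syntax; _×_; _,_; proj₁; proj₂)
open import Data.Product.Function.NonDependent.Propositional using (_×-⇔_)
open import Data.Sum.Base using (inj₁; inj₂)
open import Data.Unit.Base using (⊤; tt)
open import Function.Base using (id; _∘_)
open import Function.Bundles using (_⇔_; mk⇔; Equivalence)
open import Function.Properties.Equivalence using ()
  renaming (refl to ⇔-refl; trans to ⇔-trans)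
open import Function.Related.TypeIsomorphisms using (¬-cong-⇔)
open import Relation.Binary.PropositionalEquality
  using (_≡_; _≢_; refl; sym; trans; cong; cong₂; subst; ≢-sym)
open import Relation.Nullary using (yes; no; proof; does; ofʸ; ofⁿ; contradiction)
open import Relation.Unary using (Pred; _≐_; _⊆_)
open import Relation.Unary.Properties using (≐-refl; ≐-sym)

open Equivalence using (to; from)

private
  variable
    a p q r : Level

-- Equivalences, and updates of assignments

∃-cong-⇔ : {A : Set a} {P : A → Set p} {Q : A → Set q} →
           (∀ x → P x ⇔ Q x) → ∃ P ⇔ ∃ Q
∃-cong-⇔ eq = mk⇔ (λ (x , p) → x , to (eq x) p) (λ (x , q) → x , from (eq x) q)

-- `does (u ≟ x)` normalises to `u ≡ᵇ x`, so abstracting over `u ≟ x` alone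
-- would not reduce the conditionals; `does` and `proof` are abstracted instead.

update-elim : {A : Set a} {B : Set p} (R : A → B → Set r) (x : ℕ)
              (f : ℕ → A) (f′ : ℕ → B) {d : A} {d′ : B} → R d d′ →
              ∀ u → (u ≢ x → R (f u) (f′ u)) →
              R ((f [ x ← d ]) u) ((f′ [ x ← d′ ]) u)
update-elim R x f f′ Rd u Rf with does (u ≟ x) | proof (u ≟ x)
... | true  | ofʸ _   = Rd
... | false | ofⁿ u≢x = Rf u≢x

update-preserves : {A : Set a} (P : A → Set p) (x : ℕ) {f : ℕ → A} {d : A} →
                   P d → (∀ u → P (f u)) → ∀ u → P ((f [ x ← d ]) u)
update-preserves P x Pd Pf u with does (u ≟ x)
... | true  = Pd
... | false = Pf u

update-same : {A : Set a} (f : ℕ → A) (x : ℕ) {d : A} → (f [ x ← d ]) x ≡ d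
update-same f x with does (x ≟ x) | proof (x ≟ x)
... | true  | _       = refl
... | false | ofⁿ x≢x = contradiction refl x≢x

update-other : {A : Set a} (f : ℕ → A) (x : ℕ) {d : A} {u : ℕ} → u ≢ x →
               (f [ x ← d ]) u ≡ f u
update-other f x {u = u} u≢x with does (u ≟ x) | proof (u ≟ x)
... | true  | ofʸ u≡x = contradiction u≡x u≢x
... | false | _       = refl

subst-other : ∀ {x z u} → u ≢ x → u [ z / x ] ≡ u
subst-other {x} {u = u} u≢x with does (u ≟ x) | proof (u ≟ x)
... | true  | ofʸ u≡x = contradiction u≡x u≢x
... | false | _       = refl

subst-eliminates : ∀ {z w} → z ≢ w → ∀ u → z ≢ u [ w / z ]
subst-eliminates {z} z≢w u with does (u ≟ z) | proof (u ≟ z)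
... | true  | _       = z≢w
... | false | ofⁿ u≢z = ≢-sym u≢z

≐-cong : {A : Set a} {S T : Pred A p} {u v : A} → u ≡ v → S ≐ T → S u ⇔ T v
≐-cong refl (S⊆T , T⊆S) = mk⇔ S⊆T T⊆S

≡⇒≐ : {A : Set a} {S T : Pred A p} → S ≡ T → S ≐ T
≡⇒≐ refl = ≐-refl

lift-⇔ : {A : Set p} {B : Set q} → A ⇔ B → Level.Lift r A ⇔ Level.Lift r B
lift-⇔ eq = mk⇔ (λ p → lift (to eq (lower p))) (λ q → lift (from eq (lower q)))

≡⇒⇔ : {A B : Set p} → A ≡ B → A ⇔ B
≡⇒⇔ refl = ⇔-refl

-- Bound variables, replacement and renaming: syntactic side conditions

-- x ∈ vars₁ φ stands in for "x occurs free in φ"; it also counts bound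
-- occurrences and binders, which makes FreeFor₁ stronger than usual.

FreeFor₁ : Var → Var → Formula → Set
FreeFor₁ x z (rel r y y′) = ⊤
FreeFor₁ x z (mem Y y)    = ⊤
FreeFor₁ x z (¬′ φ)       = FreeFor₁ x z φ
FreeFor₁ x z (φ ∧′ ψ)     = FreeFor₁ x z φ × FreeFor₁ x z ψ
FreeFor₁ x z (∃¹ y φ)     = (x ∈ vars₁ φ → y ≢ z) × FreeFor₁ x z φ
FreeFor₁ x z (∃² Y φ)     = FreeFor₁ x z φ

FreeFor₂ : Var₂ → Var₂ → Formula → Set
FreeFor₂ X Z (rel r y y′) = ⊤
FreeFor₂ X Z (mem Y y)    = ⊤
FreeFor₂ X Z (¬′ φ)       = FreeFor₂ X Z φ
FreeFor₂ X Z (φ ∧′ ψ)     = FreeFor₂ X Z φ × FreeFor₂ X Z ψ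
FreeFor₂ X Z (∃¹ y φ)     = FreeFor₂ X Z φ
FreeFor₂ X Z (∃² Y φ)     = (X ∈ vars₂ φ → Y ≢ Z) × FreeFor₂ X Z φ

Unbound₁ : Var → Formula → Set
Unbound₁ z (rel r y y′) = ⊤
Unbound₁ z (mem Y y)    = ⊤
Unbound₁ z (¬′ φ)       = Unbound₁ z φ
Unbound₁ z (φ ∧′ ψ)     = Unbound₁ z φ × Unbound₁ z ψ
Unbound₁ z (∃¹ y φ)     = y ≢ z × Unbound₁ z φ
Unbound₁ z (∃² Y φ)     = Unbound₁ z φ

Unbound₂ : Var₂ → Formula → Set
Unbound₂ Z (rel r y y′) = ⊤
Unbound₂ Z (mem Y y)    = ⊤
Unbound₂ Z (¬′ φ)       = Unbound₂ Z φ
Unbound₂ Z (φ ∧′ ψ)     = Unbound₂ Z φ × Unbound₂ Z ψ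
Unbound₂ Z (∃¹ y φ)     = Unbound₂ Z φ
Unbound₂ Z (∃² Y φ)     = Y ≢ Z × Unbound₂ Z φ

unbound⇒freeFor₁ : ∀ {x z} φ → Unbound₁ z φ → FreeFor₁ x z φ
unbound⇒freeFor₁ (rel r y y′) _         = tt
unbound⇒freeFor₁ (mem Y y)    _         = tt
unbound⇒freeFor₁ (¬′ φ)       u         = unbound⇒freeFor₁ φ u
unbound⇒freeFor₁ (φ ∧′ ψ)     (u , v)   = unbound⇒freeFor₁ φ u , unbound⇒freeFor₁ ψ v
unbound⇒freeFor₁ (∃¹ y φ)     (y≢z , u) = (λ _ → y≢z) , unbound⇒freeFor₁ φ u
unbound⇒freeFor₁ (∃² Y φ)     u         = unbound⇒freeFor₁ φ u

unbound⇒freeFor₂ : ∀ {X Z} φ → Unbound₂ Z φ → FreeFor₂ X Z φ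
unbound⇒freeFor₂ (rel r y y′) _         = tt
unbound⇒freeFor₂ (mem Y y)    _         = tt
unbound⇒freeFor₂ (¬′ φ)       u         = unbound⇒freeFor₂ φ u
unbound⇒freeFor₂ (φ ∧′ ψ)     (u , v)   = unbound⇒freeFor₂ φ u , unbound⇒freeFor₂ ψ v
unbound⇒freeFor₂ (∃¹ y φ)     u         = unbound⇒freeFor₂ φ u
unbound⇒freeFor₂ (∃² Y φ)     (Y≢Z , u) = (λ _ → Y≢Z) , unbound⇒freeFor₂ φ u

∉⇒freeFor₁ : ∀ {x z} φ → x ∉ vars₁ φ → FreeFor₁ x z φ
∉⇒freeFor₁ (rel r y y′) _   = tt
∉⇒freeFor₁ (mem Y y)    _   = tt
∉⇒freeFor₁ (¬′ φ)       x∉ = ∉⇒freeFor₁ φ x∉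
∉⇒freeFor₁ (φ ∧′ ψ)     x∉ =
  ∉⇒freeFor₁ φ (x∉ ∘ ∈-++⁺ˡ) , ∉⇒freeFor₁ ψ (x∉ ∘ ∈-++⁺ʳ (vars₁ φ))
∉⇒freeFor₁ (∃¹ y φ)     x∉ =
  (λ x∈ → contradiction (there x∈) x∉) , ∉⇒freeFor₁ φ (x∉ ∘ there)
∉⇒freeFor₁ (∃² Y φ)     x∉ = ∉⇒freeFor₁ φ x∉

∉⇒freeFor₂ : ∀ {X Z} φ → X ∉ vars₂ φ → FreeFor₂ X Z φ
∉⇒freeFor₂ (rel r y y′) _   = tt
∉⇒freeFor₂ (mem Y y)    _   = tt
∉⇒freeFor₂ (¬′ φ)       X∉ = ∉⇒freeFor₂ φ X∉
∉⇒freeFor₂ (φ ∧′ ψ)     X∉ =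
  ∉⇒freeFor₂ φ (X∉ ∘ ∈-++⁺ˡ) , ∉⇒freeFor₂ ψ (X∉ ∘ ∈-++⁺ʳ (vars₂ φ))
∉⇒freeFor₂ (∃¹ y φ)     X∉ = ∉⇒freeFor₂ φ X∉
∉⇒freeFor₂ (∃² Y φ)     X∉ =
  (λ X∈ → contradiction (there X∈) X∉) , ∉⇒freeFor₂ φ (X∉ ∘ there)

unbound-replace₁ : ∀ {z} x w φ → Unbound₁ z φ → Unbound₁ z (replace₁ x w φ)
unbound-replace₁ x w (rel r y y′) _       = tt
unbound-replace₁ x w (mem Y y)    _       = tt
unbound-replace₁ x w (¬′ φ)       u       = unbound-replace₁ x w φ u
unbound-replace₁ x w (φ ∧′ ψ)     (u , v) =
  unbound-replace₁ x w φ u , unbound-replace₁ x w ψ v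
unbound-replace₁ x w (∃¹ y φ) (y≢z , u) with does (y ≟ x)
... | true  = y≢z , u
... | false = y≢z , unbound-replace₁ x w φ u
unbound-replace₁ x w (∃² Y φ)     u       = unbound-replace₁ x w φ u

unbound-replace₂ : ∀ {Z} X W φ → Unbound₂ Z φ → Unbound₂ Z (replace₂ X W φ)
unbound-replace₂ X W (rel r y y′) _       = tt
unbound-replace₂ X W (mem Y y)    _       = tt
unbound-replace₂ X W (¬′ φ)       u       = unbound-replace₂ X W φ u
unbound-replace₂ X W (φ ∧′ ψ)     (u , v) =
  unbound-replace₂ X W φ u , unbound-replace₂ X W ψ v
unbound-replace₂ X W (∃¹ y φ)     u       = unbound-replace₂ X W φ u
unbound-replace₂ X W (∃² Y φ) (Y≢Z , u) with does (Y ≟ X)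
... | true  = Y≢Z , u
... | false = Y≢Z , unbound-replace₂ X W φ u

∉-++ : ∀ {x : ℕ} xs {ys} → x ∉ xs → x ∉ ys → x ∉ xs ++ ys
∉-++ xs x∉xs x∉ys x∈ with ∈-++⁻ xs x∈
... | inj₁ x∈xs = x∉xs x∈xs
... | inj₂ x∈ys = x∉ys x∈ys

-- Replacement stops at a binder of `z`, and `vars₁` counts binders, so `z` is certain to disappear
-- only when nothing binds it.
∉-replace₁ : ∀ {z w} → z ≢ w → ∀ φ → Unbound₁ z φ → z ∉ vars₁ (replace₁ z w φ)
∉-replace₁ z≢w (rel r y y′) _ (here z≡)         = subst-eliminates z≢w y z≡
∉-replace₁ z≢w (rel r y y′) _ (there (here z≡)) = subst-eliminates z≢w y′ z≡
∉-replace₁ z≢w (mem Y y)    _ (here z≡)         = subst-eliminates z≢w y z≡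
∉-replace₁ z≢w (¬′ φ)       u       = ∉-replace₁ z≢w φ u
∉-replace₁ {z} {w} z≢w (φ ∧′ ψ) (u , v) =
  ∉-++ (vars₁ (replace₁ z w φ)) (∉-replace₁ z≢w φ u) (∉-replace₁ z≢w ψ v)
∉-replace₁ {z} z≢w (∃¹ y φ) (y≢z , u) z∈ with does (y ≟ z) | proof (y ≟ z) | z∈
... | true  | ofʸ y≡z | _         = y≢z y≡z
... | false | _       | here z≡y  = y≢z (sym z≡y)
... | false | _       | there z∈′ = ∉-replace₁ z≢w φ u z∈′
∉-replace₁ z≢w (∃² Y φ)     u       = ∉-replace₁ z≢w φ u

∉-replace₂ : ∀ {Z W} → Z ≢ W → ∀ φ → Unbound₂ Z φ → Z ∉ vars₂ (replace₂ Z W φ)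
∉-replace₂ Z≢W (mem Y y)    _ (here Z≡) = subst-eliminates Z≢W Y Z≡
∉-replace₂ Z≢W (¬′ φ)       u       = ∉-replace₂ Z≢W φ u
∉-replace₂ {Z} {W} Z≢W (φ ∧′ ψ) (u , v) =
  ∉-++ (vars₂ (replace₂ Z W φ)) (∉-replace₂ Z≢W φ u) (∉-replace₂ Z≢W ψ v)
∉-replace₂ Z≢W (∃¹ y φ)     u       = ∉-replace₂ Z≢W φ u
∉-replace₂ {Z} Z≢W (∃² Y φ) (Y≢Z , u) Z∈ with does (Y ≟ Z) | proof (Y ≟ Z) | Z∈
... | true  | ofʸ Y≡Z | _         = Y≢Z Y≡Z
... | false | _       | here Z≡Y  = Y≢Z (sym Z≡Y)
... | false | _       | there Z∈′ = ∉-replace₂ Z≢W φ u Z∈′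

unbound-renameBound₁ : ∀ {z w} → z ≢ w → ∀ φ → Unbound₁ z (renameBound₁ z w φ)
unbound-renameBound₁ z≢w (rel r y y′) = tt
unbound-renameBound₁ z≢w (mem Y y)    = tt
unbound-renameBound₁ z≢w (¬′ φ)       = unbound-renameBound₁ z≢w φ
unbound-renameBound₁ z≢w (φ ∧′ ψ)     =
  unbound-renameBound₁ z≢w φ , unbound-renameBound₁ z≢w ψ
unbound-renameBound₁ {z} {w} z≢w (∃¹ y φ) with does (y ≟ z) | proof (y ≟ z)
... | true  | _       = ≢-sym z≢w ,
  unbound-replace₁ z w (renameBound₁ z w φ) (unbound-renameBound₁ z≢w φ)
... | false | ofⁿ y≢z = y≢z , unbound-renameBound₁ z≢w φ
unbound-renameBound₁ z≢w (∃² Y φ)     = unbound-renameBound₁ z≢w φ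

unbound-renameBound₂ : ∀ {Z W} → Z ≢ W → ∀ φ → Unbound₂ Z (renameBound₂ Z W φ)
unbound-renameBound₂ Z≢W (rel r y y′) = tt
unbound-renameBound₂ Z≢W (mem Y y)    = tt
unbound-renameBound₂ Z≢W (¬′ φ)       = unbound-renameBound₂ Z≢W φ
unbound-renameBound₂ Z≢W (φ ∧′ ψ)     =
  unbound-renameBound₂ Z≢W φ , unbound-renameBound₂ Z≢W ψ
unbound-renameBound₂ Z≢W (∃¹ y φ)     = unbound-renameBound₂ Z≢W φ
unbound-renameBound₂ {Z} {W} Z≢W (∃² Y φ) with does (Y ≟ Z) | proof (Y ≟ Z)
... | true  | _       = ≢-sym Z≢W ,
  unbound-replace₂ Z W (renameBound₂ Z W φ) (unbound-renameBound₂ Z≢W φ)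
... | false | ofⁿ Y≢Z = Y≢Z , unbound-renameBound₂ Z≢W φ

-- A renamed binder w has a body from which z is gone, so it captures nothing
-- when an enclosing binder of z is renamed to w as well.

freeFor-renameBound₁ : ∀ {z w} → z ≢ w → ∀ φ → w ∉ vars₁ φ →
                       FreeFor₁ z w (renameBound₁ z w φ)
freeFor-renameBound₁ z≢w (rel r y y′) _ = tt
freeFor-renameBound₁ z≢w (mem Y y)    _ = tt
freeFor-renameBound₁ z≢w (¬′ φ)       w∉ = freeFor-renameBound₁ z≢w φ w∉
freeFor-renameBound₁ z≢w (φ ∧′ ψ)     w∉ =
  freeFor-renameBound₁ z≢w φ (w∉ ∘ ∈-++⁺ˡ) ,
  freeFor-renameBound₁ z≢w ψ (w∉ ∘ ∈-++⁺ʳ (vars₁ φ))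
freeFor-renameBound₁ {z} {w} z≢w (∃¹ y φ) w∉ with does (y ≟ z)
... | true  = (λ z∈ → contradiction z∈ z∉) , ∉⇒freeFor₁ (replace₁ z w (renameBound₁ z w φ)) z∉
  where z∉ = ∉-replace₁ z≢w (renameBound₁ z w φ) (unbound-renameBound₁ z≢w φ)
... | false = (λ _ y≡w → w∉ (here (sym y≡w))) , freeFor-renameBound₁ z≢w φ (w∉ ∘ there)
freeFor-renameBound₁ z≢w (∃² Y φ)     w∉ = freeFor-renameBound₁ z≢w φ w∉

freeFor-renameBound₂ : ∀ {Z W} → Z ≢ W → ∀ φ → W ∉ vars₂ φ →
                       FreeFor₂ Z W (renameBound₂ Z W φ)
freeFor-renameBound₂ Z≢W (rel r y y′) _ = tt
freeFor-renameBound₂ Z≢W (mem Y y)    _ = tt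
freeFor-renameBound₂ Z≢W (¬′ φ)       W∉ = freeFor-renameBound₂ Z≢W φ W∉
freeFor-renameBound₂ Z≢W (φ ∧′ ψ)     W∉ =
  freeFor-renameBound₂ Z≢W φ (W∉ ∘ ∈-++⁺ˡ) ,
  freeFor-renameBound₂ Z≢W ψ (W∉ ∘ ∈-++⁺ʳ (vars₂ φ))
freeFor-renameBound₂ Z≢W (∃¹ y φ)     W∉ = freeFor-renameBound₂ Z≢W φ W∉
freeFor-renameBound₂ {Z} {W} Z≢W (∃² Y φ) W∉ with does (Y ≟ Z)
... | true  = (λ Z∈ → contradiction Z∈ Z∉) , ∉⇒freeFor₂ (replace₂ Z W (renameBound₂ Z W φ)) Z∉
  where Z∉ = ∉-replace₂ Z≢W (renameBound₂ Z W φ) (unbound-renameBound₂ Z≢W φ)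
... | false = (λ _ Y≡W → W∉ (here (sym Y≡W))) , freeFor-renameBound₂ Z≢W φ (W∉ ∘ there)

-- The form in which the hypothesis of the substitution lemma passes under a
-- binder y of a body with variables xs.

update-∘-subst : ∀ {A : Set a} {h g : ℕ → A} {d x z y xs} → y ≢ x → (x ∈ xs → y ≢ z) →
                 (∀ {u} → u ∈ xs → h u ≡ g (u [ z / x ])) →
                 ∀ {u} → u ∈ xs → (h [ y ← d ]) u ≡ (g [ y ← d ]) (u [ z / x ])
update-∘-subst {h = h} {g} {d} {x} {z} {y} y≢x y≢z eq {u} u∈
  with does (u ≟ x) | proof (u ≟ x) | eq u∈
... | true  | ofʸ refl | hx = trans (update-other h y (≢-sym y≢x))
  (trans hx (sym (update-other g y (≢-sym (y≢z u∈)))))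
... | false | _        | hu = update-elim _≡_ y h g refl u (λ _ → hu)

-- Coincidence and substitution lemmas for the Henkin semantics

module _ {U : Set a} {I : Interpretation U} {D : Pred U a} {E : SetFamily U} where

  -- Set assignments are compared up to `≐`, because membership in `Range₂` determines a set only up
  -- to `≐`.
  coincidence : ∀ φ {g g′ G G′} →
                (∀ {u} → u ∈ vars₁ φ → g u ≡ g′ u) →
                (∀ {X} → X ∈ vars₂ φ → G X ≐ G′ X) →
                (⟨ I , D , E ⟩, g , G ⊨ φ) ⇔ (⟨ I , D , E ⟩, g′ , G′ ⊨ φ)
  coincidence (rel r x y) p₁ p₂ =
    lift-⇔ (≡⇒⇔ (cong₂ (I r) (p₁ (here refl)) (p₁ (there (here refl)))))
  coincidence (mem X x) p₁ p₂ = lift-⇔ (≐-cong (p₁ (here refl)) (p₂ (here refl)))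
  coincidence (¬′ φ) p₁ p₂ = ¬-cong-⇔ (coincidence φ p₁ p₂)
  coincidence (φ ∧′ ψ) p₁ p₂ =
    coincidence φ (p₁ ∘ ∈-++⁺ˡ) (p₂ ∘ ∈-++⁺ˡ) ×-⇔
    coincidence ψ (p₁ ∘ ∈-++⁺ʳ (vars₁ φ)) (p₂ ∘ ∈-++⁺ʳ (vars₂ φ))
  coincidence (∃¹ x φ) {g} {g′} p₁ p₂ = ∃-cong-⇔ λ d → ⇔-refl ×-⇔ coincidence φ
    (λ {u} u∈ → update-elim _≡_ x g g′ refl u (λ _ → p₁ (there u∈))) p₂
  coincidence (∃² X φ) {G = G} {G′} p₁ p₂ = ∃-cong-⇔ λ S → ⇔-refl ×-⇔ coincidence φ p₁
    (λ {Y} Y∈ → update-elim _≐_ X G G′ ≐-refl Y (λ _ → p₂ (there Y∈)))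

  -- The assignment `h` is constrained only on the variables of `φ`, not fixed as `g [ x ← g z ]`:
  -- under a binder, updates made in different orders agree only pointwise, and no function
  -- extensionality is available to identify them.
  ⊨-replace₁ : ∀ {x z} φ → FreeFor₁ x z φ → ∀ {g h G} →
               (∀ {u} → u ∈ vars₁ φ → h u ≡ g (u [ z / x ])) →
               (⟨ I , D , E ⟩, g , G ⊨ replace₁ x z φ) ⇔ (⟨ I , D , E ⟩, h , G ⊨ φ)
  ⊨-replace₁ (rel r y y′) _ eq =
    lift-⇔ (≡⇒⇔ (sym (cong₂ (I r) (eq (here refl)) (eq (there (here refl))))))
  ⊨-replace₁ (mem Y y) _ {G = G} eq = lift-⇔ (≡⇒⇔ (sym (cong (G Y) (eq (here refl)))))
  ⊨-replace₁ (¬′ φ) ff eq = ¬-cong-⇔ (⊨-replace₁ φ ff eq)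
  ⊨-replace₁ (φ ∧′ ψ) (ff , ff′) eq =
    ⊨-replace₁ φ ff (eq ∘ ∈-++⁺ˡ) ×-⇔ ⊨-replace₁ ψ ff′ (eq ∘ ∈-++⁺ʳ (vars₁ φ))
  ⊨-replace₁ {x} {z} (∃¹ y φ) (nc , ff) {g} {h} eq with does (y ≟ x) | proof (y ≟ x)
  -- A binder of `x` stops the replacement, so the two bodies coincide; on their variables `g` and
  -- `h` can differ only at `x`, which the binder overwrites.
  ... | true  | ofʸ refl = ∃-cong-⇔ λ d → ⇔-refl ×-⇔ coincidence φ
    (λ {u} u∈ → update-elim _≡_ x g h refl u λ u≢x →
      sym (trans (eq (there u∈)) (cong g (subst-other u≢x))))
    (λ _ → ≐-refl)
  ... | false | ofⁿ y≢x  = ∃-cong-⇔ λ d → ⇔-refl ×-⇔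
    ⊨-replace₁ φ ff (update-∘-subst {h = h} {g} y≢x nc (eq ∘ there))
  ⊨-replace₁ (∃² Y φ) ff eq = ∃-cong-⇔ λ S → ⇔-refl ×-⇔ ⊨-replace₁ φ ff eq

  ⊨-replace₂ : ∀ {X Z} φ → FreeFor₂ X Z φ → ∀ {g G H} →
               (∀ {Y} → Y ∈ vars₂ φ → H Y ≡ G (Y [ Z / X ])) →
               (⟨ I , D , E ⟩, g , G ⊨ replace₂ X Z φ) ⇔ (⟨ I , D , E ⟩, g , H ⊨ φ)
  ⊨-replace₂ (rel r y y′) _ eq = ⇔-refl
  ⊨-replace₂ (mem Y y) _ {g} eq = lift-⇔ (≐-cong refl (≐-sym (≡⇒≐ (eq (here refl)))))
  ⊨-replace₂ (¬′ φ) ff eq = ¬-cong-⇔ (⊨-replace₂ φ ff eq)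
  ⊨-replace₂ (φ ∧′ ψ) (ff , ff′) eq =
    ⊨-replace₂ φ ff (eq ∘ ∈-++⁺ˡ) ×-⇔ ⊨-replace₂ ψ ff′ (eq ∘ ∈-++⁺ʳ (vars₂ φ))
  ⊨-replace₂ (∃¹ y φ) ff eq = ∃-cong-⇔ λ d → ⇔-refl ×-⇔ ⊨-replace₂ φ ff eq
  ⊨-replace₂ {X} {Z} (∃² Y φ) (nc , ff) {G = G} {H} eq with does (Y ≟ X) | proof (Y ≟ X)
  ... | true  | ofʸ refl = ∃-cong-⇔ λ S → ⇔-refl ×-⇔ coincidence φ
    (λ _ → refl)
    (λ {V} V∈ → update-elim _≐_ X G H ≐-refl V λ V≢X →
      ≡⇒≐ (sym (trans (eq (there V∈)) (cong G (subst-other V≢X)))))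
  ... | false | ofⁿ Y≢X  = ∃-cong-⇔ λ S → ⇔-refl ×-⇔
    ⊨-replace₂ φ ff (update-∘-subst {h = H} {G} Y≢X nc (eq ∘ there))

  ⊨-renameBound₁ : ∀ {z w} → z ≢ w → ∀ φ → w ∉ vars₁ φ → ∀ {g G} →
                   (⟨ I , D , E ⟩, g , G ⊨ renameBound₁ z w φ) ⇔ (⟨ I , D , E ⟩, g , G ⊨ φ)
  ⊨-renameBound₁ z≢w (rel r y y′) _ = ⇔-refl
  ⊨-renameBound₁ z≢w (mem Y y) _ = ⇔-refl
  ⊨-renameBound₁ z≢w (¬′ φ) w∉ = ¬-cong-⇔ (⊨-renameBound₁ z≢w φ w∉)
  ⊨-renameBound₁ z≢w (φ ∧′ ψ) w∉ =
    ⊨-renameBound₁ z≢w φ (w∉ ∘ ∈-++⁺ˡ) ×-⇔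
    ⊨-renameBound₁ z≢w ψ (w∉ ∘ ∈-++⁺ʳ (vars₁ φ))
  ⊨-renameBound₁ {z} {w} z≢w (∃¹ y φ) w∉ {g} with does (y ≟ z) | proof (y ≟ z)
  -- With `w` set to `d`, replacing `z` by `w` amounts to setting `z` to `d` as well. The value of
  -- `w` can then be dropped, since `w` does not occur in `φ`.
  ... | true  | ofʸ refl = ∃-cong-⇔ λ d → ⇔-refl ×-⇔
    ⇔-trans (⊨-replace₁ (renameBound₁ z w φ) (freeFor-renameBound₁ z≢w φ w∉φ)
                        (λ {u} _ → swapped d u))
    (⇔-trans (⊨-renameBound₁ z≢w φ w∉φ)
             (coincidence φ (λ {u} u∈ → update-elim _≡_ z (g [ w ← d ]) g refl u λ _ →
                               update-other g w (λ { refl → w∉φ u∈ }))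
                            (λ _ → ≐-refl)))
    where
    w∉φ = w∉ ∘ there
    swapped : ∀ d u → ((g [ w ← d ]) [ z ← d ]) u ≡ (g [ w ← d ]) (u [ w / z ])
    swapped d u with does (u ≟ z)
    ... | true  = sym (update-same g w)
    ... | false = refl
  ... | false | _ = ∃-cong-⇔ λ d → ⇔-refl ×-⇔ ⊨-renameBound₁ z≢w φ (w∉ ∘ there)
  ⊨-renameBound₁ z≢w (∃² Y φ) w∉ =
    ∃-cong-⇔ λ S → ⇔-refl ×-⇔ ⊨-renameBound₁ z≢w φ w∉

  ⊨-renameBound₂ : ∀ {Z W} → Z ≢ W → ∀ φ → W ∉ vars₂ φ → ∀ {g G} →
                   (⟨ I , D , E ⟩, g , G ⊨ renameBound₂ Z W φ) ⇔ (⟨ I , D , E ⟩, g , G ⊨ φ)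
  ⊨-renameBound₂ Z≢W (rel r y y′) _ = ⇔-refl
  ⊨-renameBound₂ Z≢W (mem Y y) _ = ⇔-refl
  ⊨-renameBound₂ Z≢W (¬′ φ) W∉ = ¬-cong-⇔ (⊨-renameBound₂ Z≢W φ W∉)
  ⊨-renameBound₂ Z≢W (φ ∧′ ψ) W∉ =
    ⊨-renameBound₂ Z≢W φ (W∉ ∘ ∈-++⁺ˡ) ×-⇔
    ⊨-renameBound₂ Z≢W ψ (W∉ ∘ ∈-++⁺ʳ (vars₂ φ))
  ⊨-renameBound₂ Z≢W (∃¹ y φ) W∉ =
    ∃-cong-⇔ λ d → ⇔-refl ×-⇔ ⊨-renameBound₂ Z≢W φ W∉
  ⊨-renameBound₂ {Z} {W} Z≢W (∃² Y φ) W∉ {G = G} with does (Y ≟ Z) | proof (Y ≟ Z)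
  ... | true  | ofʸ refl = ∃-cong-⇔ λ S → ⇔-refl ×-⇔
    ⇔-trans (⊨-replace₂ (renameBound₂ Z W φ) (freeFor-renameBound₂ Z≢W φ W∉φ)
                        (λ {V} _ → swapped S V))
    (⇔-trans (⊨-renameBound₂ Z≢W φ W∉φ)
             (coincidence φ (λ _ → refl)
                            (λ {V} V∈ → update-elim _≐_ Z (G [ W ← S ]) G ≐-refl V λ _ →
                               ≡⇒≐ (update-other G W (λ { refl → W∉φ V∈ })))))
    where
    W∉φ = W∉ ∘ there
    swapped : ∀ S V → ((G [ W ← S ]) [ Z ← S ]) V ≡ (G [ W ← S ]) (V [ W / Z ])
    swapped S V with does (V ≟ Z)
    ... | true  = sym (update-same G W)
    ... | false = refl
  ... | false | _ = ∃-cong-⇔ λ S → ⇔-refl ×-⇔ ⊨-renameBound₂ Z≢W φ (W∉ ∘ there)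

  -- Freshness of `w` makes the renaming preserve truth. Afterwards no binder of `z` is left, so
  -- nothing can capture the `z` put in place of `x`.
  ⊨-subst₁ : ∀ x z φ {g G} →
             (⟨ I , D , E ⟩, g , G ⊨ [ x ←ᵣ z ] φ) ⇔ (⟨ I , D , E ⟩, g [ x ← g z ] , G ⊨ φ)
  ⊨-subst₁ x z φ {g} = ⇔-trans
    (⊨-replace₁ (renameBound₁ z w φ)
      (unbound⇒freeFor₁ (renameBound₁ z w φ) (unbound-renameBound₁ z≢w φ))
      (λ {u} _ → updated u))
    (⊨-renameBound₁ z≢w φ (w∉ ∘ there ∘ there))
    where
    w = fresh (x ∷ z ∷ vars₁ φ)
    w∉ = proj₁ (proj₂ (leastFresh (x ∷ z ∷ vars₁ φ)))
    z≢w : z ≢ w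
    z≢w z≡w = w∉ (there (here (sym z≡w)))
    updated : ∀ u → (g [ x ← g z ]) u ≡ g (u [ z / x ])
    updated u with does (u ≟ x)
    ... | true  = refl
    ... | false = refl

  ⊨-subst₂ : ∀ X Z φ {g G} →
             (⟨ I , D , E ⟩, g , G ⊨ [ X ←ᵣ₂ Z ] φ) ⇔ (⟨ I , D , E ⟩, g , G [ X ← G Z ] ⊨ φ)
  ⊨-subst₂ X Z φ {G = G} = ⇔-trans
    (⊨-replace₂ (renameBound₂ Z W φ)
      (unbound⇒freeFor₂ (renameBound₂ Z W φ) (unbound-renameBound₂ Z≢W φ))
      (λ {V} _ → updated V))
    (⊨-renameBound₂ Z≢W φ (W∉ ∘ there ∘ there))
    where
    W = fresh (X ∷ Z ∷ vars₂ φ)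
    W∉ = proj₁ (proj₂ (leastFresh (X ∷ Z ∷ vars₂ φ)))
    Z≢W : Z ≢ W
    Z≢W Z≡W = W∉ (there (here (sym Z≡W)))
    updated : ∀ V → (G [ X ← G Z ]) V ≡ G (V [ Z / X ])
    updated V with does (V ≟ X)
    ... | true  = refl
    ... | false = refl

-- The shallow translation as range-relative truth

module _ {U : Set a} {II : Interpretation U} {gg : Assignment U} {GG : Assignment₂ U} where

  -- Recursion is on the accessibility proof, as `[ x ←ᵣ z ] φ` is not a subformula of `∃¹ x φ`.
  -- Quantifying over all such proofs makes the hypothesis fit whichever one `shallowAcc` passes on.
  shallowAcc⇔⊨ : ∀ φ (rec : Acc _<_ (size φ)) →
                 shallowAcc II gg GG φ rec ⇔ (⟨ II , Range gg , Range₂ GG ⟩, gg , GG ⊨ φ)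
  shallowAcc⇔⊨ (rel r x y) _ = mk⇔ lift lower
  shallowAcc⇔⊨ (mem X x) _ = mk⇔ lift lower
  shallowAcc⇔⊨ (¬′ φ) (acc rs) = ¬-cong-⇔ (shallowAcc⇔⊨ φ _)
  shallowAcc⇔⊨ (φ ∧′ ψ) (acc rs) = shallowAcc⇔⊨ φ _ ×-⇔ shallowAcc⇔⊨ ψ _
  shallowAcc⇔⊨ (∃¹ x φ) (acc rs) = mk⇔
    (λ (z , s) → gg z , (z , refl) ,
      to (⊨-subst₁ x z φ) (to (shallowAcc⇔⊨ ([ x ←ᵣ z ] φ) _) s))
    (λ { (_ , (z , refl) , s) → z ,
      from (shallowAcc⇔⊨ ([ x ←ᵣ z ] φ) _) (from (⊨-subst₁ x z φ) s) })
  shallowAcc⇔⊨ (∃² X φ) (acc rs) = mk⇔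
    (λ (Z , s) → GG Z , (Z , ≐-refl) ,
      to (⊨-subst₂ X Z φ) (to (shallowAcc⇔⊨ ([ X ←ᵣ₂ Z ] φ) _) s))
    -- `S` is only `≐` to `GG Z`, so `coincidence` trades one for the other.
    (λ (S , (Z , GZ≐S) , s) → Z ,
      from (shallowAcc⇔⊨ ([ X ←ᵣ₂ Z ] φ) _) (from (⊨-subst₂ X Z φ)
        (from (coincidence φ (λ _ → refl)
                 (λ {V} _ → update-elim _≐_ X GG GG GZ≐S V (λ _ → ≐-refl))) s)))

-- Enumerating pairs and binary trees

next : ℕ × ℕ → ℕ × ℕ
next (zero  , b) = suc b , zero
next (suc a , b) = a , suc b

-- The inverse of a Cantor pairing: `next` moves along an antidiagonal and, at its end, to the start
-- of the following one.
unpair : ℕ → ℕ × ℕ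
unpair zero    = zero , zero
unpair (suc n) = next (unpair n)

unpair-surjective : ∀ a b → ∃[ n ] unpair n ≡ (a , b)
unpair-surjective a b = reach (a + b) a b refl
  where
  -- Induction on the antidiagonal `s`, then on `b`: `(a , suc b)` follows `(suc a , b)`, while
  -- `(suc a , zero)` follows the end `(zero , a)` of the previous antidiagonal.
  reach : ∀ s a b → a + b ≡ s → ∃[ n ] unpair n ≡ (a , b)
  reach s a (suc b) eq with n , p ← reach s (suc a) b (trans (sym (+-suc a b)) eq) =
    suc n , cong next p
  reach s zero zero eq = zero , refl
  reach (suc s) (suc a) zero eq
    with n , p ← reach s zero a (trans (sym (+-identityʳ a)) (suc-injective eq)) =
    suc n , cong next p

-- A common format for the codes of `Formula` and `Env`; the former nest inside the latter, so one
-- enumeration of trees covers both.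
data Tree : Set where
  leaf : ℕ → Tree
  node : Tree → Tree → Tree

decodeℕ : ℕ → ℕ → Tree
decodeℕ zero    n = leaf zero
decodeℕ (suc k) n with unpair n
... | zero  , m = leaf m
... | suc i , m = node (decodeℕ k i) (decodeℕ k m)

-- Fuel sufficient for decoding. A leaf takes one unit, since `decodeℕ zero` ignores its code; a sum
-- in place of a maximum leaves each subtree its own height plus a remainder.
height : Tree → ℕ
height (leaf m)   = 1
height (node s t) = suc (height s + height t)

-- The first argument of decodeℕ is fuel, and any amount from the height on
-- gives the same tree.

decodeℕ-surjective : ∀ t → ∃[ n ] (∀ k → decodeℕ (height t + k) n ≡ t)
decodeℕ-surjective (leaf m) with n , p ← unpair-surjective 0 m = n , decoded
  where
  decoded : ∀ k → decodeℕ (suc k) n ≡ leaf m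
  decoded k rewrite p = refl
decodeℕ-surjective (node s t)
  with i , ps ← decodeℕ-surjective s | m , pt ← decodeℕ-surjective t
  with n , p ← unpair-surjective (suc i) m = n , decoded
  where
  decoded : ∀ k → decodeℕ (suc (height s + height t + k)) n ≡ node s t
  decoded k rewrite p = cong₂ node
    (trans (cong (λ h → decodeℕ h i) (+-assoc (height s) (height t) k)) (ps _))
    (trans (cong (λ h → decodeℕ h m)
                 (trans (cong (_+ k) (+-comm (height s) (height t)))
                        (+-assoc (height t) (height s) k)))
           (pt _))

-- The fuel is enumerated along with the code, since no fixed amount suffices for all trees.
enumTree : ℕ → Tree
enumTree n with k , m ← unpair n = decodeℕ k m

enumTree-surjective : ∀ t → ∃[ n ] enumTree n ≡ t
enumTree-surjective t with m , p ← decodeℕ-surjective t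
  with n , q ← unpair-surjective (height t + 0) m = n , found
  where
  found : enumTree n ≡ t
  found rewrite q = p 0

-- Coding formulas and environments by trees

encodeFormula : Formula → Tree
encodeFormula (rel r x y) = node (leaf 0) (node (leaf r) (node (leaf x) (leaf y)))
encodeFormula (mem X x)   = node (leaf 1) (node (leaf X) (leaf x))
encodeFormula (¬′ φ)      = node (leaf 2) (encodeFormula φ)
encodeFormula (φ ∧′ ψ)    = node (leaf 3) (node (encodeFormula φ) (encodeFormula ψ))
encodeFormula (∃¹ x φ)    = node (leaf 4) (node (leaf x) (encodeFormula φ))
encodeFormula (∃² X φ)    = node (leaf 5) (node (leaf X) (encodeFormula φ))

decodeFormula : Tree → Formula
decodeFormula (node (leaf 0) (node (leaf r) (node (leaf x) (leaf y)))) = rel r x y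
decodeFormula (node (leaf 1) (node (leaf X) (leaf x))) = mem X x
decodeFormula (node (leaf 2) t)                        = ¬′ decodeFormula t
decodeFormula (node (leaf 3) (node s t))               = decodeFormula s ∧′ decodeFormula t
decodeFormula (node (leaf 4) (node (leaf x) t))        = ∃¹ x (decodeFormula t)
decodeFormula (node (leaf 5) (node (leaf X) t))        = ∃² X (decodeFormula t)
-- An arbitrary value for trees that code no formula: a left inverse of the encoding is enough for
-- surjectivity.
decodeFormula _                                        = rel 0 0 0

decode-encodeFormula : ∀ φ → decodeFormula (encodeFormula φ) ≡ φ
decode-encodeFormula (rel r x y) = refl
decode-encodeFormula (mem X x)   = refl
decode-encodeFormula (¬′ φ)      = cong ¬′_ (decode-encodeFormula φ)
decode-encodeFormula (φ ∧′ ψ)    = cong₂ _∧′_ (decode-encodeFormula φ) (decode-encodeFormula ψ)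
decode-encodeFormula (∃¹ x φ)    = cong (∃¹ x) (decode-encodeFormula φ)
decode-encodeFormula (∃² X φ)    = cong (∃² X) (decode-encodeFormula φ)

-- Names for the pairs of assignments reachable from an initial one: wit₁ ψ x e
-- updates x to a witness for ∃¹ x ψ under e, and upd₁ e x f y updates x in e to
-- the value of y under f.

data Env : Set where
  init : Env
  wit₁ : Formula → Var → Env → Env
  wit₂ : Formula → Var₂ → Env → Env
  upd₁ : Env → Var → Env → Var → Env
  upd₂ : Env → Var₂ → Env → Var₂ → Env

encodeEnv : Env → Tree
encodeEnv init           = leaf 0
encodeEnv (wit₁ ψ x e)   = node (leaf 0) (node (encodeFormula ψ) (node (leaf x) (encodeEnv e)))
encodeEnv (wit₂ ψ X e)   = node (leaf 1) (node (encodeFormula ψ) (node (leaf X) (encodeEnv e)))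
encodeEnv (upd₁ e x f y) =
  node (leaf 2) (node (encodeEnv e) (node (leaf x) (node (encodeEnv f) (leaf y))))
encodeEnv (upd₂ e X f Y) =
  node (leaf 3) (node (encodeEnv e) (node (leaf X) (node (encodeEnv f) (leaf Y))))

decodeEnv : Tree → Env
decodeEnv (node (leaf 0) (node p (node (leaf x) t))) = wit₁ (decodeFormula p) x (decodeEnv t)
decodeEnv (node (leaf 1) (node p (node (leaf X) t))) = wit₂ (decodeFormula p) X (decodeEnv t)
decodeEnv (node (leaf 2) (node s (node (leaf x) (node t (leaf y))))) =
  upd₁ (decodeEnv s) x (decodeEnv t) y
decodeEnv (node (leaf 3) (node s (node (leaf X) (node t (leaf Y))))) =
  upd₂ (decodeEnv s) X (decodeEnv t) Y
decodeEnv _ = init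

decode-encodeEnv : ∀ e → decodeEnv (encodeEnv e) ≡ e
decode-encodeEnv init           = refl
decode-encodeEnv (wit₁ ψ x e)   =
  cong₂ (λ ψ e → wit₁ ψ x e) (decode-encodeFormula ψ) (decode-encodeEnv e)
decode-encodeEnv (wit₂ ψ X e)   =
  cong₂ (λ ψ e → wit₂ ψ X e) (decode-encodeFormula ψ) (decode-encodeEnv e)
decode-encodeEnv (upd₁ e x f y) =
  cong₂ (λ e f → upd₁ e x f y) (decode-encodeEnv e) (decode-encodeEnv f)
decode-encodeEnv (upd₂ e X f Y) =
  cong₂ (λ e f → upd₂ e X f Y) (decode-encodeEnv e) (decode-encodeEnv f)

-- A pair names the value of one variable under one environment. Both namespaces are ℕ, so the same
-- list serves individuals and sets.
enumPair : ℕ → Env × ℕ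
enumPair n with i , x ← unpair n = decodeEnv (enumTree i) , x

enumPair-surjective : ∀ e x → ∃[ n ] enumPair n ≡ (e , x)
enumPair-surjective e x
  with i , p ← enumTree-surjective (encodeEnv e)
  with n , q ← unpair-surjective i x = n , found
  where
  found : enumPair n ≡ (e , x)
  found rewrite q | p = cong (_, x) (decode-encodeEnv e)

-- Prescribing an initial segment of a sequence

-- `k` is shifted by `N`, not overwritten, so the result still attains every value of `k`.
splice : {A : Set a} → ℕ → (ℕ → A) → (ℕ → A) → ℕ → A
splice zero    f k n       = k n
splice (suc N) f k zero    = f zero
splice (suc N) f k (suc n) = splice N (f ∘ suc) k n

splice-< : {A : Set a} {N : ℕ} (f k : ℕ → A) {n : ℕ} → n < N → splice N f k n ≡ f n
splice-< {N = suc N} f k {zero}  _         = refl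
splice-< {N = suc N} f k {suc n} (s≤s n<N) = splice-< (f ∘ suc) k n<N

splice-+ : {A : Set a} (N : ℕ) (f k : ℕ → A) (n : ℕ) → splice N f k (N + n) ≡ k n
splice-+ zero    f k n = refl
splice-+ (suc N) f k n = splice-+ N (f ∘ suc) k n

splice-preserves : {A : Set a} (P : A → Set p) (N : ℕ) {f k : ℕ → A} →
                   (∀ n → P (f n)) → (∀ n → P (k n)) → ∀ n → P (splice N f k n)
splice-preserves P zero    Pf Pk n       = Pk n
splice-preserves P (suc N) Pf Pk zero    = Pf zero
splice-preserves P (suc N) Pf Pk (suc n) = splice-preserves P N (Pf ∘ suc) Pk n

bound : List ℕ → ℕ
bound xs = suc (max 0 xs)

∈⇒<bound : ∀ {x} xs → x ∈ xs → x < bound xs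
∈⇒<bound xs x∈ = s≤s (All.lookup (xs≤max 0 xs) x∈)

-- The Skolem hull

module LöwenheimSkolem
  (em : ExcludedMiddle (lsuc a)) {U : Set a}
  (I : Interpretation U) (D : Pred U a) (E : SetFamily U)
  (g : Assignment U) (G : Assignment₂ U)
  (g⊆D : Range g ⊆ D) (G⊆E : member (Range₂ G) ⊆ member E)
  where

  -- Since ∃ is a Σ-type, excluded middle also chooses the witnesses.

  witness₁ : ∀ ψ x h H → ∃[ d ] (D d ×
    ((⟨ I , D , E ⟩, h , H ⊨ ∃¹ x ψ) → (⟨ I , D , E ⟩, h [ x ← d ] , H ⊨ ψ)))
  witness₁ ψ x h H with em {⟨ I , D , E ⟩, h , H ⊨ ∃¹ x ψ}
  ... | yes (d , d∈D , s) = d , d∈D , λ _ → s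
  -- Without a witness any element of `D` will do, and `g` supplies one.
  ... | no ¬s             = g 0 , g⊆D (0 , refl) , λ s → contradiction s ¬s

  witness₂ : ∀ ψ X h H → ∃[ S ] (member E S ×
    ((⟨ I , D , E ⟩, h , H ⊨ ∃² X ψ) → (⟨ I , D , E ⟩, h , H [ X ← S ] ⊨ ψ)))
  witness₂ ψ X h H with em {⟨ I , D , E ⟩, h , H ⊨ ∃² X ψ}
  ... | yes (S , S∈E , s) = S , S∈E , λ _ → s
  ... | no ¬s             = G 0 , G⊆E (0 , ≐-refl) , λ s → contradiction s ¬s

  env₁ : Env → Assignment U
  env₂ : Env → Assignment₂ U

  env₁ init           = g
  env₁ (wit₁ ψ x e)   = env₁ e [ x ← proj₁ (witness₁ ψ x (env₁ e) (env₂ e)) ]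
  env₁ (wit₂ ψ X e)   = env₁ e
  env₁ (upd₁ e x f y) = env₁ e [ x ← env₁ f y ]
  env₁ (upd₂ e X f Y) = env₁ e

  env₂ init           = G
  env₂ (wit₁ ψ x e)   = env₂ e
  env₂ (wit₂ ψ X e)   = env₂ e [ X ← proj₁ (witness₂ ψ X (env₁ e) (env₂ e)) ]
  env₂ (upd₁ e x f y) = env₂ e
  env₂ (upd₂ e X f Y) = env₂ e [ X ← env₂ f Y ]

  -- Makes every witness taken from the hull admissible in `D`.
  env₁-∈ : ∀ e x → D (env₁ e x)
  env₁-∈ init           = λ x → g⊆D (x , refl)
  env₁-∈ (wit₁ ψ x e)   =
    update-preserves D x (proj₁ (proj₂ (witness₁ ψ x (env₁ e) (env₂ e)))) (env₁-∈ e)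
  env₁-∈ (wit₂ ψ X e)   = env₁-∈ e
  env₁-∈ (upd₁ e x f y) = update-preserves D x (env₁-∈ f y) (env₁-∈ e)
  env₁-∈ (upd₂ e X f Y) = env₁-∈ e

  env₂-∈ : ∀ e X → member E (env₂ e X)
  env₂-∈ init           = λ X → G⊆E (X , ≐-refl)
  env₂-∈ (wit₁ ψ x e)   = env₂-∈ e
  env₂-∈ (wit₂ ψ X e)   =
    update-preserves (member E) X (proj₁ (proj₂ (witness₂ ψ X (env₁ e) (env₂ e)))) (env₂-∈ e)
  env₂-∈ (upd₁ e x f y) = env₂-∈ e
  env₂-∈ (upd₂ e X f Y) = update-preserves (member E) X (env₂-∈ f Y) (env₂-∈ e)

  module _ (N : ℕ) where

    -- The tail lists the values of all environments, those of `g` included through `init`. The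
    -- prefix adds no new value; it makes the enumeration agree with `g` below `N`.
    hull₁ : Assignment U
    hull₁ = splice N g (λ n → env₁ (proj₁ (enumPair n)) (proj₂ (enumPair n)))

    hull₂ : Assignment₂ U
    hull₂ = splice N G (λ n → env₂ (proj₁ (enumPair n)) (proj₂ (enumPair n)))

    env₁∈hull : ∀ e x → Range hull₁ (env₁ e x)
    env₁∈hull e x with n , p ← enumPair-surjective e x =
      N + n , trans (splice-+ N g _ n) (cong (λ (e , x) → env₁ e x) p)

    env₂∈hull : ∀ e X → ∃[ n ] hull₂ n ≡ env₂ e X
    env₂∈hull e X with n , p ← enumPair-surjective e X =
      N + n , trans (splice-+ N G _ n) (cong (λ (e , X) → env₂ e X) p)

    hull₁⊆env : ∀ n → ∃[ e ] ∃[ x ] env₁ e x ≡ hull₁ n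
    hull₁⊆env = splice-preserves (λ d → ∃[ e ] ∃[ x ] env₁ e x ≡ d) N
      (λ n → init , n , refl) (λ n → proj₁ (enumPair n) , proj₂ (enumPair n) , refl)

    hull₂⊆env : ∀ n → ∃[ e ] ∃[ X ] env₂ e X ≡ hull₂ n
    hull₂⊆env = splice-preserves (λ S → ∃[ e ] ∃[ X ] env₂ e X ≡ S) N
      (λ n → init , n , refl) (λ n → proj₁ (enumPair n) , proj₂ (enumPair n) , refl)

    -- A Tarski-Vaught argument. It runs over all environments because each quantifier changes the
    -- environment: to `wit₁` or `wit₂` on the way into the hull, to `upd₁` or `upd₂` on the way
    -- out.
    ⊨-hull : ∀ ψ e → (⟨ I , D , E ⟩, env₁ e , env₂ e ⊨ ψ) ⇔
                     (⟨ I , Range hull₁ , Range₂ hull₂ ⟩, env₁ e , env₂ e ⊨ ψ)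
    ⊨-hull (rel r x y) e = ⇔-refl
    ⊨-hull (mem X x)   e = ⇔-refl
    ⊨-hull (¬′ ψ)      e = ¬-cong-⇔ (⊨-hull ψ e)
    ⊨-hull (ψ ∧′ χ)    e = ⊨-hull ψ e ×-⇔ ⊨-hull χ e
    ⊨-hull (∃¹ x ψ)    e = mk⇔
      -- The chosen witness is presented as the value of `x` under `wit₁ ψ x e`, the form in which
      -- it is known to lie in the hull.
      (λ s → env₁ (wit₁ ψ x e) x , env₁∈hull (wit₁ ψ x e) x ,
        subst (λ d → ⟨ I , Range hull₁ , Range₂ hull₂ ⟩, env₁ e [ x ← d ] , env₂ e ⊨ ψ)
          (sym (update-same (env₁ e) x))
          (to (⊨-hull ψ (wit₁ ψ x e))
            (proj₂ (proj₂ (witness₁ ψ x (env₁ e) (env₂ e))) s)))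
      -- An element of the hull is the value of some `y` under some `f`, so the updated assignment
      -- is by definition that of `upd₁ e x f y`.
      (λ { (_ , (n , refl) , s) →
        let f , y , p = hull₁⊆env n in
        env₁ f y , env₁-∈ f y , from (⊨-hull ψ (upd₁ e x f y))
          (subst (λ d → ⟨ I , Range hull₁ , Range₂ hull₂ ⟩, env₁ e [ x ← d ] , env₂ e ⊨ ψ)
            (sym p) s) })
    ⊨-hull (∃² X ψ)    e = mk⇔
      (λ s → env₂ (wit₂ ψ X e) X ,
        (let n , p = env₂∈hull (wit₂ ψ X e) X in n , ≡⇒≐ p) ,
        subst (λ S → ⟨ I , Range hull₁ , Range₂ hull₂ ⟩, env₁ e , env₂ e [ X ← S ] ⊨ ψ)
          (sym (update-same (env₂ e) X))
          (to (⊨-hull ψ (wit₂ ψ X e))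
            (proj₂ (proj₂ (witness₂ ψ X (env₁ e) (env₂ e))) s)))
      (λ (S , (n , hull≐S) , s) →
        let f , Y , p = hull₂⊆env n in
        env₂ f Y , env₂-∈ f Y , from (⊨-hull ψ (upd₂ e X f Y))
          -- The named set is only `≐` to `S`.
          (from (coincidence ψ (λ _ → refl) (λ {V} _ →
              update-elim _≐_ X (env₂ e) (env₂ e)
                (subst (_≐ S) (sym p) hull≐S) V (λ _ → ≐-refl)))
            s))

-- Faithfulness to general validity

rangeValid⇒generallyValid : ExcludedMiddle (lsuc a) → {U : Set a} (φ : Formula) →
  ((I : Interpretation U) (g : Assignment U) (G : Assignment₂ U) →
     ⟨ I , Range g , Range₂ G ⟩, g , G ⊨ φ) →
  GenerallyValid U φ
rangeValid⇒generallyValid em φ valid I D E g G g⊆D G⊆E =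
  from (⊨-hull N φ init)
    (to (coincidence φ (λ u∈ → splice-< g _ (∈⇒<bound xs (∈-++⁺ˡ u∈)))
                       (λ X∈ → ≡⇒≐ (splice-< G _ (∈⇒<bound xs (∈-++⁺ʳ (vars₁ φ) X∈)))))
        (valid I (hull₁ N) (hull₂ N)))
  where
  open LöwenheimSkolem em I D E g G g⊆D G⊆E
  -- Both hulls are spliced at the same index, so one `N` must exceed the variables of both kinds.
  xs = vars₁ φ ++ vars₂ φ
  N = bound xs

theorem1 : ∀ {a} → ExcludedMiddle (lsuc a) →
    (U : Set a) → U → (φ : Formula) →
    ( ((I : Interpretation U) (g : Assignment U) (G : Assignment₂ U) →
    ⟨ I , Range g , Range₂ G ⟩, g , G ⊨ φ)
    ⇔ GenerallyValid U φ )
    ×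
    ( GenerallyValid U φ
    ⇔ ((II : Interpretation U) (gg : Assignment U) (GG : Assignment₂ U) →
    shallow II gg GG φ) )
theorem1 em U _ φ =
  -- Conversely, range-relative validity is the instance `D = Range g`, `E = Range₂ G`, with
  -- identities as the two inclusions.
  mk⇔ (rangeValid⇒generallyValid em φ) (λ valid I g G → valid I _ _ g G id id) ,
  mk⇔ (λ valid II gg GG → from (shallowAcc⇔⊨ φ _) (valid II _ _ gg GG id id))
      (λ valid → rangeValid⇒generallyValid em φ
         (λ I g G → to (shallowAcc⇔⊨ φ _) (valid I g G)))
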